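{- The satisfiability problem for HyperQPTL formulas in the $\forall\exists$ fragment is undecidable: there is no algorithm that, given a HyperQPTL formula whose trace quantifier prefix is a universal trace quantifier followed by an existential one, decides whether some set of traces $T$ satisfies it.
   Context: Traces are $t\in(2^{AP})^\omega$, $t[i]$ the $i$-th element. HyperQPTL syntax: $\varphi ::= \forall\pi.\varphi \mid \exists\pi.\varphi \mid \exists q.\varphi \mid \forall q.\varphi \mid \psi$, $\psi ::= a_\pi \mid q \mid \neg\psi \mid \psi\vee\psi \mid \mathsf{X}\psi \mid \psi\,\mathsf{U}\,\psi$ (prenex quantifiers; $\pi$ trace variables, $q$ propositional variables). Semantics over a trace set $T$, assignment $\Pi$ (trace variables to traces of $T$, each propositional variable $q$ to a trace in $(2^{\{q\}})^\omega$), position $i$: $a_\pi$ holds iff $a\in\Pi(\pi)[i]$; $q$ holds iff $q\in\Pi(q)[i]$; $\mathsf X$, $\mathsf U$, Boolean connectives as in LTL; $\exists\pi$ ranges over $T$, $\exists q$ over $(2^{\{q\}})^\omega$; universal quantifiers dual; $T\models\varphi$ iff $\emptyset,0\models_T\varphi$. Fragments are defined by the trace quantifier prefix only.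
   Formalization: The set of traces T is required to be nonempty; with the empty set allowed, every formula in the ∀∃ fragment is vacuously satisfied and the problem would be trivially decidable. -}

module Defs where

open import Data.Nat using (ℕ; zero; suc; _+_; _*_; _^_; _≤_; _<_)
open import Data.Fin using (Fin)
import Data.Fin as F
open import Data.Vec using (Vec; []; _∷_)
open import Data.Bool using (Bool; true; false; T)
open import Data.List using (List; []; _∷_)
open import Data.Product using (Σ; _×_; _,_)
open import Data.Sum using (_⊎_)
open import Relation.Nullary using (¬_)
open import Relation.Binary.PropositionalEquality using (_≡_)

-- HyperQPTL syntax (well-scoped, de Bruijn).
-- Atomic propositions AP = ℕ.
-- n = number of trace variables in scope, m = number of propositional
-- variables in scope.  Closed formulas are  Formula 0 0.

data Body (n m : ℕ) : Set where
  atom  : ℕ → Fin n → Body n m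
  pvar  : Fin m → Body n m
  neg   : Body n m → Body n m
  _∨_   : Body n m → Body n m → Body n m
  X     : Body n m → Body n m
  _U_   : Body n m → Body n m → Body n m

data Formula (n m : ℕ) : Set where
  ∀π   : Formula (suc n) m → Formula n m
  ∃π   : Formula (suc n) m → Formula n m
  ∃q   : Formula n (suc m) → Formula n m
  ∀q   : Formula n (suc m) → Formula n m
  body : Body n m → Formula n m

tracePrefix : ∀ {n m} → Formula n m → List Bool
tracePrefix (∀π φ)   = true ∷ tracePrefix φ
tracePrefix (∃π φ)   = false ∷ tracePrefix φ
tracePrefix (∃q φ)   = tracePrefix φ
tracePrefix (∀q φ)   = tracePrefix φ
tracePrefix (body _) = []

ForallExists : Formula 0 0 → Set
ForallExists φ = tracePrefix φ ≡ true ∷ false ∷ []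

Trace : Set
Trace = ℕ → ℕ → Bool          -- t i a  ⇔  a ∈ t[i]

PTrace : Set
PTrace = ℕ → Bool             -- a trace over 2^{q}

extend : ∀ {k} {A : Set} → A → (Fin k → A) → Fin (suc k) → A
extend a ρ F.zero    = a
extend a ρ (F.suc i) = ρ i

_⊨B_at_ : ∀ {n m} → (Fin n → Trace) × (Fin m → PTrace) → Body n m → ℕ → Set
(Π , Q) ⊨B atom a π at i = T (Π π i a)
(Π , Q) ⊨B pvar q   at i = T (Q q i)
E ⊨B neg ψ   at i = ¬ (E ⊨B ψ at i)
E ⊨B (ψ ∨ χ) at i = (E ⊨B ψ at i) ⊎ (E ⊨B χ at i)
E ⊨B X ψ     at i = E ⊨B ψ at suc i
E ⊨B (ψ U χ) at i =
  Σ ℕ λ k → i ≤ k × (E ⊨B χ at k) × (∀ j → i ≤ j → j < k → E ⊨B ψ at j)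

Models : (TS : Trace → Set) → ∀ {n m} → (Fin n → Trace) × (Fin m → PTrace) → Formula n m → Set
Models TS (Π , Q) (∀π φ)   = (t : Trace) → TS t → Models TS (extend t Π , Q) φ
Models TS (Π , Q) (∃π φ)   = Σ Trace λ t → TS t × Models TS (extend t Π , Q) φ
Models TS (Π , Q) (∃q φ)   = Σ PTrace λ p → Models TS (Π , extend p Q) φ
Models TS (Π , Q) (∀q φ)   = (p : PTrace) → Models TS (Π , extend p Q) φ
Models TS E       (body ψ) = E ⊨B ψ at 0

emptyEnv : (Fin 0 → Trace) × (Fin 0 → PTrace)
emptyEnv = (λ ()) , (λ ())

_⊨_ : (Trace → Set) → Formula 0 0 → Set
TS ⊨ φ = Models TS emptyEnv φ

Satisfiable : Formula 0 0 → Set₁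
Satisfiable φ = Σ (Trace → Set) λ TS → Σ Trace TS × (TS ⊨ φ)

pair : ℕ → ℕ → ℕ
pair a b = 2 ^ a * (2 * b + 1)

tag : ℕ → ℕ → ℕ
tag = pair

codeFin : ∀ {k} → Fin k → ℕ
codeFin = F.toℕ

codeB : ∀ {n m} → Body n m → ℕ
codeB (atom a π) = tag 0 (pair a (codeFin π))
codeB (pvar q)   = tag 1 (codeFin q)
codeB (neg ψ)    = tag 2 (codeB ψ)
codeB (ψ ∨ χ)    = tag 3 (pair (codeB ψ) (codeB χ))
codeB (X ψ)      = tag 4 (codeB ψ)
codeB (ψ U χ)    = tag 5 (pair (codeB ψ) (codeB χ))

code : ∀ {n m} → Formula n m → ℕ
code (∀π φ)   = tag 0 (code φ)
code (∃π φ)   = tag 1 (code φ)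
code (∃q φ)   = tag 2 (code φ)
code (∀q φ)   = tag 3 (code φ)
code (body ψ) = tag 4 (codeB ψ)

data Rec : ℕ → Set where
  zer  : ∀ {k} → Rec k
  succ : Rec 1
  proj : ∀ {k} → Fin k → Rec k
  comp : ∀ {k j} → Rec j → Vec (Rec k) j → Rec k
  prec : ∀ {k} → Rec k → Rec (suc (suc k)) → Rec (suc k)
  mu   : ∀ {k} → Rec (suc k) → Rec k

data Eval : ∀ {k} → Rec k → Vec ℕ k → ℕ → Set
data EvalAll : ∀ {k j} → Vec (Rec k) j → Vec ℕ k → Vec ℕ j → Set

data Eval where
  e-zer  : ∀ {k} {xs : Vec ℕ k} → Eval zer xs 0
  e-succ : ∀ {x} → Eval succ (x ∷ []) (suc x)
  e-proj : ∀ {k} {xs : Vec ℕ k} (i : Fin k) → Eval (proj i) xs (Data.Vec.lookup xs i)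
  e-comp : ∀ {k j} {f : Rec j} {gs : Vec (Rec k) j} {xs ys y} →
           EvalAll gs xs ys → Eval f ys y → Eval (comp f gs) xs y
  e-prec0 : ∀ {k} {g : Rec k} {h : Rec (suc (suc k))} {xs y} →
            Eval g xs y → Eval (prec g h) (0 ∷ xs) y
  e-precS : ∀ {k} {g : Rec k} {h : Rec (suc (suc k))} {xs x z y} →
            Eval (prec g h) (x ∷ xs) z → Eval h (x ∷ z ∷ xs) y →
            Eval (prec g h) (suc x ∷ xs) y
  e-mu   : ∀ {k} {f : Rec (suc k)} {xs n} →
           Eval f (n ∷ xs) 0 →
           (∀ i → i < n → Σ ℕ λ v → Eval f (i ∷ xs) (suc v)) →
           Eval (mu f) xs n

data EvalAll where
  ea-[] : ∀ {k} {xs : Vec ℕ k} → EvalAll [] xs []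
  ea-∷  : ∀ {k j} {g : Rec k} {gs : Vec (Rec k) j} {xs y ys} →
          Eval g xs y → EvalAll gs xs ys → EvalAll (g ∷ gs) xs (y ∷ ys)

DecidesSatAE : Rec 1 → Set₁
DecidesSatAE d = ∀ (φ : Formula 0 0) → ForallExists φ →
  (Eval d (code φ ∷ []) 1 × Satisfiable φ) ⊎ (Eval d (code φ ∷ []) 0 × ¬ Satisfiable φ)

{-# OPTIONS --safe #-}
module Submission where

-- A trace codes a configuration of a register machine: atom 0 holds exactly at the position
-- of the program counter, atom r + 1 exactly at the value of register r.  Under the prefix
-- ∀q ∀π ∃π' the bit q[0] asks for two witnesses π' per π: a successor configuration of π if it is
-- set, the initial configuration otherwise.  So the formula is satisfiable iff the machine
-- runs forever on the given input.  The input n enters only through Xⁿ, so the code of the formula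
-- is a recursive function of n and the code of the machine-dependent part V.  Given a
-- decider d, take the machine that on input x decides by d the formula with code V = x = n, halts
-- if the answer is 1 and loops if it is 0; running it on the code of its own V contradicts d.

open import Defs
open import Data.Bool using (true; false; T)
open import Data.Bool.Properties using (T?)
open import Data.Empty using (⊥)
open import Data.Fin using (Fin; zero; suc)
open import Data.List using (List; []; _∷_; _++_; length)
open import Data.Maybe using (Maybe; just; nothing)
open import Data.Nat using (ℕ; zero; suc; _+_; _*_; _^_; _⊔_; _≤_; _<_; z≤n; s≤s; _≡ᵇ_; _≟_)
open import Data.Nat.Properties
open import Data.Product using (Σ; ∃; _×_; _,_; proj₁; proj₂)
open import Data.Sum using (_⊎_; inj₁; inj₂)
open import Data.Unit using (tt)
open import Data.Vec using (Vec; []; _∷_; map; lookup)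
open import Data.Vec.Properties using (lookup-map)
open import Data.Vec.Relation.Unary.All using (All; []; _∷_)
import Data.Vec.Relation.Unary.All as All
open import Function using (_∘_; id; case_of_)
open import Relation.Binary.Construct.Closure.ReflexiveTransitive using (Star; ε; _◅_; _◅◅_)
open import Relation.Binary.PropositionalEquality
open import Relation.Nullary using (¬_; yes; no; contradiction)
open import Relation.Nullary.Decidable using (decidable-stable)

-- Register machines

Store : Set
Store = ℕ → ℕ

_[_↦_] : Store → ℕ → ℕ → Store
(ρ [ d ↦ v ]) r with r ≟ d
... | yes _ = v
... | no  _ = ρ r

↦-same : ∀ ρ d v → (ρ [ d ↦ v ]) d ≡ v
↦-same ρ d v with d ≟ d
... | yes _  = refl
... | no d≢d = contradiction refl d≢d

↦-other : ∀ ρ {d} v {r} → r ≢ d → (ρ [ d ↦ v ]) r ≡ ρ r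
↦-other ρ {d} v {r} r≢d with r ≟ d
... | yes r≡d = contradiction r≡d r≢d
... | no _    = refl

-- Constants and shifts are updates that a temporal formula can check: it matches position `i + a`
-- of one trace with position `i + b` of the other.
data Expr : Set where
  const : ℕ → Expr
  shift : (s a b : ℕ) → Expr

-- shift s a b is s - a + b and is undefined if s < a.
data _⊢_⇓_ (ρ : Store) : Expr → ℕ → Set where
  const : ∀ {c} → ρ ⊢ const c ⇓ c
  shift : ∀ {s a b v} → ρ s ≡ a + v → ρ ⊢ shift s a b ⇓ (b + v)

copy incr decr : ℕ → Expr
copy s = shift s 0 0
incr s = shift s 0 1
decr s = shift s 1 0

copy-⇓ : ∀ ρ s → ρ ⊢ copy s ⇓ ρ s
copy-⇓ ρ s = shift refl

next : ℕ → Expr → ℕ → Expr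
next d e r with r ≟ d
... | yes _ = e
... | no  _ = copy r

next-⇓ : ∀ {ρ d e v} → ρ ⊢ e ⇓ v → ∀ r → ρ ⊢ next d e r ⇓ (ρ [ d ↦ v ]) r
next-⇓ {d = d} ev r with r ≟ d
... | yes _ = ev
... | no  _ = shift refl

data Instr : Set where
  set  : ℕ → Expr → Instr
  br   : (r ifZero ifPos : ℕ) → Instr
  stop : Instr

Program : Set
Program = List Instr

fetch : Program → ℕ → Maybe Instr
fetch []      _       = nothing
fetch (i ∷ _) zero    = just i
fetch (_ ∷ P) (suc l) = fetch P l

fetch-just⇒< : ∀ P {l i} → fetch P l ≡ just i → l < length P
fetch-just⇒< (_ ∷ _) {zero}  _  = s≤s z≤n
fetch-just⇒< (_ ∷ P) {suc _} eq = s≤s (fetch-just⇒< P eq)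

Config : Set
Config = ℕ × Store

data Step (P : Program) : Config → Config → Set where
  set : ∀ {l ρ d e v} → fetch P l ≡ just (set d e) → ρ ⊢ e ⇓ v →
        Step P (l , ρ) (suc l , ρ [ d ↦ v ])
  br0 : ∀ {l ρ r m n} → fetch P l ≡ just (br r m n) → ρ r ≡ 0 →
        Step P (l , ρ) (m , ρ)
  br+ : ∀ {l ρ r m n v} → fetch P l ≡ just (br r m n) → ρ r ≡ suc v →
        Step P (l , ρ) (n , ρ)

Steps : Program → Config → Config → Set
Steps P = Star (Step P)

srcBound : Expr → ℕ
srcBound (const _)     = 0
srcBound (shift s _ _) = suc s

-- Only reads are counted: the formula has to track just those registers that some step can inspect.
regBound : Instr → ℕ
regBound (set _ e)  = srcBound e
regBound (br r _ _) = suc r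
regBound stop       = 0

maxReg : Program → ℕ
maxReg []      = 0
maxReg (i ∷ P) = regBound i ⊔ maxReg P

regBound≤maxReg : ∀ P {l i} → fetch P l ≡ just i → regBound i ≤ maxReg P
regBound≤maxReg (i ∷ P) {zero}  refl = m≤m⊔n (regBound i) (maxReg P)
regBound≤maxReg (i ∷ P) {suc l} eq   = m≤n⇒m≤o⊔n (regBound i) (regBound≤maxReg P eq)

next-bounded : ∀ {R} d e {r} → srcBound e ≤ R → r < R → srcBound (next d e r) ≤ R
next-bounded d e {r} e≤R r<R with r ≟ d
... | yes _ = e≤R
... | no  _ = r<R

-- Temporal formulas

_∧_ : ∀ {n m} → Body n m → Body n m → Body n m
ψ ∧ χ = neg (neg ψ ∨ neg χ)

Xs : ∀ {n m} → ℕ → Body n m → Body n m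
Xs zero    ψ = ψ
Xs (suc k) ψ = X (Xs k ψ)

-- Excluded middle on a propositional variable stands in for a truth constant; it holds
-- constructively because the values are Booleans.
top : ∀ {n m} → Body n (suc m)
top = pvar zero ∨ neg (pvar zero)

F : ∀ {n m} → Body n (suc m) → Body n (suc m)
F ψ = top U ψ

⋁ : ∀ {n m} → ℕ → (ℕ → Body n (suc m)) → Body n (suc m)
⋁ zero    g = neg top
⋁ (suc k) g = g k ∨ ⋁ k g

∧-intro : ∀ {n m} E (ψ χ : Body n m) {i} → E ⊨B ψ at i → E ⊨B χ at i → E ⊨B ψ ∧ χ at i
∧-intro E ψ χ p q (inj₁ ¬p) = ¬p p
∧-intro E ψ χ p q (inj₂ ¬q) = ¬q q

-- Conjunction is encoded through `neg`, so it yields its components only on the way to a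
-- contradiction.
∧-refute : ∀ {n m} E (ψ χ : Body n m) {i} → (E ⊨B ψ at i → ¬ E ⊨B χ at i) → ¬ E ⊨B ψ ∧ χ at i
∧-refute E ψ χ r ¬¬ = ¬¬ (inj₁ λ p → ¬¬ (inj₂ (r p)))

Xs-sem : ∀ {n m} E k (ψ : Body n m) i → (E ⊨B Xs k ψ at i) ≡ (E ⊨B ψ at (i + k))
Xs-sem E zero    ψ i = cong (E ⊨B ψ at_) (sym (+-identityʳ i))
Xs-sem E (suc k) ψ i = trans (Xs-sem E k ψ (suc i)) (cong (E ⊨B ψ at_) (sym (+-suc i k)))

top-holds : ∀ {n m} E i → E ⊨B top {n} {m} at i
top-holds (Π , Q) i with T? (Q zero i)
... | yes q = inj₁ q
... | no ¬q = inj₂ ¬q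

F-intro : ∀ {n m} E (ψ : Body n (suc m)) k → E ⊨B ψ at k → E ⊨B F ψ at 0
F-intro E ψ k p = k , z≤n , p , λ j _ _ → top-holds E j

⋁-intro : ∀ {n m} E k (g : ℕ → Body n (suc m)) {i j} → j < k → E ⊨B g j at i → E ⊨B ⋁ k g at i
⋁-intro E (suc k) g {j = j} (s≤s j≤k) p with m≤n⇒m<n∨m≡n j≤k
... | inj₁ j<k  = inj₂ (⋁-intro E k g j<k p)
... | inj₂ refl = inj₁ p

⋁-refute : ∀ {n m} E k (g : ℕ → Body n (suc m)) {i} → (∀ j → ¬ E ⊨B g j at i) → ¬ E ⊨B ⋁ k g at i
⋁-refute E zero    g r ¬top     = ¬top (top-holds E _)
⋁-refute E (suc k) g r (inj₁ p) = r k p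
⋁-refute E (suc k) g r (inj₂ p) = ⋁-refute E k g r p

-- The formula of a program

Cond : Set
Cond = Body 2 1

now then : ℕ → Cond
now a  = atom a (suc zero)
then a = atom a zero

isStep : Cond
isStep = pvar zero

-- The formulas named …Bad hold when the pair of traces violates a requirement.
exprBad : ℕ → Expr → Cond
exprBad d (const c)     = neg (Xs c (then (suc d)))
exprBad d (shift s a b) = F (Xs a (now (suc s)) ∧ neg (Xs b (then (suc d))))

moveBad : ℕ → ℕ → (ℕ → Expr) → Cond
moveBad R l u = neg (Xs l (then 0)) ∨ ⋁ R (λ r → exprBad r (u r))

instrBad : ℕ → ℕ → Maybe Instr → Cond
instrBad R l (just (set d e))  = moveBad R (suc l) (next d e)
instrBad R l (just (br r m n)) =
  -- A zero register has its atom at position 0, a positive one at some later position, seen through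
  -- `X`.
  (now (suc r) ∧ moveBad R m copy) ∨ (F (X (now (suc r))) ∧ moveBad R n copy)
-- Every candidate successor of a halted configuration is a violation.
instrBad R l (just stop)       = top
instrBad R l nothing           = neg top

stepBad : Program → ℕ → Cond
stepBad P l = isStep ∧ (Xs l (now 0) ∧ instrBad (maxReg P) l (fetch P l))

-- Register 0 holds the input and is constrained separately, in runs.
initBad : ℕ → Cond
initBad R = neg isStep ∧ (neg (then 0) ∨ ⋁ R (λ r → neg (then (2 + r))))

bad : Program → Cond
bad P = ⋁ (length P) (stepBad P) ∨ initBad (maxReg P)

-- Outside step mode, the negated right disjunct forces register 0 to hold `n`. With `V` a direct
-- subterm, its code can be inserted as it is.
runs : Cond → ℕ → Formula 0 0
runs V n = ∀q (∀π (∃π (body (neg (V ∨ neg (isStep ∨ Xs n (then 1)))))))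

-- Halting runs exclude models

env : Trace → Trace → PTrace → (Fin 2 → Trace) × (Fin 1 → PTrace)
env t t' p = extend t' (extend t (proj₁ emptyEnv)) , extend p (proj₂ emptyEnv)

input : ℕ → Store
input n zero    = n
input n (suc _) = 0

-- One-sided on purpose: the formula of a program only propagates truth of atoms,
-- so nothing about their falsity has to be maintained along a run.
record Represents (R : ℕ) (t : Trace) (c : Config) : Set where
  constructor _,_
  field
    label : T (t (proj₁ c) 0)
    regs  : ∀ r → r < R → T (t (proj₂ c r) (suc r))

T-stable : ∀ {b} → ¬ ¬ T b → T b
T-stable {b} = decidable-stable (T? b)

Xs-now : ∀ t t' p k a i → (env t t' p ⊨B Xs k (now a) at i) ≡ T (t (i + k) a)
Xs-now t t' p k a i = Xs-sem (env t t' p) k (now a) i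

Xs-then : ∀ t t' p k a i → (env t t' p ⊨B Xs k (then a) at i) ≡ T (t' (i + k) a)
Xs-then t t' p k a i = Xs-sem (env t t' p) k (then a) i

Xs-then-stable : ∀ t t' p k a i → ¬ ¬ (env t t' p ⊨B Xs k (then a) at i) → T (t' (i + k) a)
Xs-then-stable t t' p k a i rewrite Xs-then t t' p k a i = T-stable

module _ (t t' : Trace) (p : PTrace) where
  private E = env t t' p

  -- For a shift, `v` is the witness of `F`: the source atom holds at `v + a`, so avoiding the
  -- violation forces the target atom at `v + b`, the new value.
  expr-sound : ∀ {R l ρ e v} d → Represents R t (l , ρ) → srcBound e ≤ R → ρ ⊢ e ⇓ v →
               ¬ E ⊨B exprBad d e at 0 → T (t' v (suc d))
  expr-sound d rep _ (const {c}) ok = Xs-then-stable t t' p c (suc d) 0 ok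
  expr-sound {ρ = ρ} d (_ , regs) s<R (shift {s} {a} {b} {v} eq) ok =
    subst (λ i → T (t' i (suc d))) (+-comm v b)
      (Xs-then-stable t t' p b (suc d) v λ ¬then →
        ok (F-intro E (Xs a (now (suc s)) ∧ neg (Xs b (then (suc d)))) v
          (∧-intro E (Xs a (now (suc s))) (neg (Xs b (then (suc d))))
            (subst id (sym (Xs-now t t' p a (suc s) v))
              (subst (λ i → T (t i (suc s))) (trans eq (+-comm a v)) (regs s s<R)))
            ¬then)))

  move-sound : ∀ {R l m ρ ρ' u} → Represents R t (l , ρ) → (∀ {r} → r < R → srcBound (u r) ≤ R) →
               (∀ r → ρ ⊢ u r ⇓ ρ' r) → ¬ E ⊨B moveBad R m u at 0 → Represents R t' (m , ρ')
  move-sound {R} {m = m} {u = u} rep bnd ev ok =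
    Xs-then-stable t t' p m 0 0 (ok ∘ inj₁) ,
    λ r r<R → expr-sound r rep (bnd r<R) (ev r)
                (ok ∘ inj₂ ∘ ⋁-intro E R (λ r → exprBad r (u r)) r<R)

  step-sound : ∀ P {c c'} → T (p 0) → Represents (maxReg P) t c → Step P c c' →
               ¬ E ⊨B ⋁ (length P) (stepBad P) at 0 → Represents (maxReg P) t' c'
  step-sound P {l , ρ} {c'} p0 rep st ok = go st
    where
    R = maxReg P
    instr-ok : ∀ {i} → fetch P l ≡ just i → ¬ E ⊨B instrBad R l (just i) at 0
    instr-ok eq b = ok (⋁-intro E (length P) (stepBad P) (fetch-just⇒< P eq)
      (∧-intro E isStep (Xs l (now 0) ∧ instrBad R l (fetch P l)) p0
        (∧-intro E (Xs l (now 0)) (instrBad R l (fetch P l))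
          (subst id (sym (Xs-now t t' p l 0 0)) (Represents.label rep))
          (subst (λ f → E ⊨B instrBad R l f at 0) (sym eq) b))))
    go : Step P (l , ρ) c' → Represents R t' c'
    go (set {d = d} {e} eq ev) =
      move-sound rep (next-bounded d e (regBound≤maxReg P eq)) (next-⇓ ev) (instr-ok eq)
    go (br0 {r = r} {m} eq z) =
      move-sound rep (λ r<R → r<R) (copy-⇓ _) λ b → instr-ok eq (inj₁
        (∧-intro E (now (suc r)) (moveBad R m copy)
          (subst (λ i → T (t i (suc r))) z (Represents.regs rep r (regBound≤maxReg P eq))) b))
    go (br+ {r = r} {n = n} {v} eq s) =
      move-sound rep (λ r<R → r<R) (copy-⇓ _) λ b → instr-ok eq (inj₂
        (∧-intro E (F (X (now (suc r)))) (moveBad R n copy)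
          -- The register holds `suc v`, so `X` sees its atom from position `v`.
          (F-intro E (X (now (suc r))) v
            (subst (λ i → T (t i (suc r))) s (Represents.regs rep r (regBound≤maxReg P eq)))) b))

  stop-sound : ∀ P {l ρ} → T (p 0) → Represents (maxReg P) t (l , ρ) → fetch P l ≡ just stop →
               E ⊨B ⋁ (length P) (stepBad P) at 0
  stop-sound P {l} p0 rep eq = ⋁-intro E (length P) (stepBad P) (fetch-just⇒< P eq)
    (∧-intro E isStep (Xs l (now 0) ∧ instrBad R l (fetch P l)) p0
      (∧-intro E (Xs l (now 0)) (instrBad R l (fetch P l))
        (subst id (sym (Xs-now t t' p l 0 0)) (Represents.label rep))
        (subst (λ f → E ⊨B instrBad R l f at 0) (sym eq) (top-holds E 0))))
    where R = maxReg P

  init-sound : ∀ {R} n → ¬ T (p 0) → ¬ E ⊨B initBad R at 0 →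
               ¬ ¬ (E ⊨B (isStep ∨ Xs n (then 1)) at 0) → Represents R t' (0 , input n)
  init-sound {R} n ¬p0 ok ¬¬inp = T-stable (λ ¬l → ok' (inj₁ ¬l)) , regs
    where
    others = ⋁ R (λ r → neg (then (2 + r)))
    ok' : ¬ E ⊨B (neg (then 0) ∨ others) at 0
    ok' = ok ∘ ∧-intro E (neg isStep) (neg (then 0) ∨ others) ¬p0
    regs : ∀ r → r < R → T (t' (input n r) (suc r))
    regs zero    _     = Xs-then-stable t t' p n 1 0 λ ¬x → ¬¬inp λ { (inj₁ p0) → ¬p0 p0 ; (inj₂ x) → ¬x x }
    -- Index `r` of the disjunction stands for register `suc r`, whose atom is `2 + r`.
    regs (suc r) r<R = T-stable λ ¬x → ok' (inj₂ (⋁-intro E R (λ r → neg (then (2 + r))) (<-trans (n<1+n r) r<R) ¬x))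

-- From any trace of a model, the all-false `q` yields a trace of the initial configuration.
-- Repeating the all-true `q` follows the run inside the model until `stop` forbids a witness.
halting⇒unsatisfiable : ∀ P n {l ρ} → Steps P (0 , input n) (l , ρ) → fetch P l ≡ just stop →
                        ¬ Satisfiable (runs (bad P) n)
halting⇒unsatisfiable P n {l} {ρ} run halt (TS , (t₀ , ts₀) , model) =
  case model (λ _ → false) t₀ ts₀ of λ { (t , ts , ok) →
    follow run ts (init-sound t₀ t (λ _ → false) n (λ ()) (ok ∘ inj₁ ∘ inj₂) (ok ∘ inj₂)) }
  where
  follow : ∀ {c t} → Steps P c (l , ρ) → TS t → Represents (maxReg P) t c → ⊥
  follow {t = t} ε ts rep = case model (λ _ → true) t ts of λ { (t' , ts' , ok) →
    ok (inj₁ (inj₁ (stop-sound t t' (λ _ → true) P tt rep halt))) }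
  follow {t = t} (st ◅ sts) ts rep = case model (λ _ → true) t ts of λ { (t' , ts' , ok) →
    follow sts ts' (step-sound t t' (λ _ → true) P tt rep st (ok ∘ inj₁ ∘ inj₁)) }

-- Looping runs give models

encode : Config → Trace
encode (l , ρ) i zero    = i ≡ᵇ l
encode (l , ρ) i (suc r) = i ≡ᵇ ρ r

module _ (l : ℕ) (ρ : Store) (m : ℕ) (ρ' : Store) (p : PTrace) where
  private
    t  = encode (l , ρ)
    t' = encode (m , ρ')
    E  = env t t' p

  then-holds : ∀ k d i → i + k ≡ ρ' d → E ⊨B Xs k (then (suc d)) at i
  then-holds k d i eq rewrite Xs-then t t' p k (suc d) i = ≡⇒≡ᵇ (i + k) (ρ' d) eq

  -- A register atom of an encoded trace holds at a single position, so every witness of `F` equals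
  -- `v`, where the target atom is as required.
  expr-complete : ∀ {e} d → ρ ⊢ e ⇓ ρ' d → ¬ E ⊨B exprBad d e at 0
  expr-complete {e} d ev = go e _ ev refl
    where
    -- The value is a separate variable `v` because the index `ρ' d` would block matching on the
    -- evaluation.
    go : ∀ e v → ρ ⊢ e ⇓ v → v ≡ ρ' d → ¬ E ⊨B exprBad d e at 0
    go _ _ (const {c}) eq ¬x = ¬x (then-holds c d 0 eq)
    go _ _ (shift {s} {a} {b} {v} ρs) eq (i , _ , x , _) =
      ∧-refute E (Xs a (now (suc s))) (neg (Xs b (then (suc d))))
        (λ y ¬z → ¬z (then-holds b d i
          (trans (trans (cong (_+ b) (i≡v (subst id (Xs-now t t' p a (suc s) i) y))) (+-comm v b)) eq)))
        x
      where
      i≡v : T (i + a ≡ᵇ ρ s) → i ≡ v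
      i≡v y = +-cancelʳ-≡ a i v (trans (≡ᵇ⇒≡ (i + a) (ρ s) y) (trans ρs (+-comm a v)))

  move-complete : ∀ R u → (∀ r → ρ ⊢ u r ⇓ ρ' r) → ¬ E ⊨B moveBad R m u at 0
  move-complete R u ev (inj₁ ¬x) = ¬x (subst id (sym (Xs-then t t' p m 0 0)) (≡⇒≡ᵇ m m refl))
  move-complete R u ev (inj₂ x) = ⋁-refute E R (λ r → exprBad r (u r)) (λ r → expr-complete {u r} r (ev r)) x

-- The label atom holds at `l` alone, so only the current instruction could be violated, and the
-- given step meets its demands.
step-complete : ∀ P {c c'} p → Step P c c' → ∀ l' → ¬ env (encode c) (encode c') p ⊨B stepBad P l' at 0
step-complete P {l , ρ} {m , ρ'} p st l' =
  ∧-refute E isStep (Xs l' (now 0) ∧ instrBad R l' (fetch P l')) λ _ →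
  ∧-refute E (Xs l' (now 0)) (instrBad R l' (fetch P l')) λ x →
    go (≡ᵇ⇒≡ l' l (subst id (Xs-now (encode (l , ρ)) (encode (m , ρ')) p l' 0 0) x)) st
  where
  E = env (encode (l , ρ)) (encode (m , ρ')) p
  R = maxReg P
  go : ∀ {m ρ'} → l' ≡ l → Step P (l , ρ) (m , ρ') →
       ¬ env (encode (l , ρ)) (encode (m , ρ')) p ⊨B instrBad R l' (fetch P l') at 0
  go refl (set {d = d} {e} {v} eq ev) rewrite eq =
    move-complete l ρ (suc l) (ρ [ d ↦ v ]) p R (next d e) (next-⇓ ev)
  go refl (br0 {r = r} {m} {n} eq z) rewrite eq = λ
    { (inj₁ x) → ∧-refute _ (now (suc r)) (moveBad R m copy)
        (λ _ → move-complete l ρ m ρ p R copy (copy-⇓ ρ)) x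
    ; (inj₂ x) → ∧-refute _ (F (X (now (suc r)))) (moveBad R n copy)
        (λ { (k , _ , y , _) _ → 1+n≢0 (trans (≡ᵇ⇒≡ (suc k) (ρ r) y) z) }) x }
  go refl (br+ {r = r} {m} {n} eq s) rewrite eq = λ
    { (inj₁ x) → ∧-refute _ (now (suc r)) (moveBad R m copy)
        (λ y _ → 0≢1+n (trans (≡ᵇ⇒≡ 0 (ρ r) y) s)) x
    ; (inj₂ x) → ∧-refute _ (F (X (now (suc r)))) (moveBad R n copy)
        (λ _ → move-complete l ρ n ρ p R copy (copy-⇓ ρ)) x }

-- The witnessing set of traces encodes the configurations that reach the self-loop at c.
looping⇒satisfiable : ∀ P n {c} → Steps P (0 , input n) c → Step P c c → Satisfiable (runs (bad P) n)
looping⇒satisfiable P n {c} run loop = TS , (encode start , start , refl , run) , model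
  where
  start : Config
  start = 0 , input n
  R = maxReg P
  TS : Trace → Set
  TS t = Σ Config λ c₁ → t ≡ encode c₁ × Steps P c₁ c
  successor : ∀ {c₁} → Steps P c₁ c → ∃ λ c₂ → Step P c₁ c₂ × Steps P c₂ c
  -- At the end of the run the self-loop supplies the successor, so a finite run suffices.
  successor ε          = _ , loop , ε
  successor (st ◅ sts) = _ , st , sts
  model : TS ⊨ runs (bad P) n
  model p _ (c₁ , refl , sts) with T? (p 0)
  ... | yes p0 = let c₂ , st , sts' = successor sts; E = env (encode c₁) (encode c₂) p in
    encode c₂ , (c₂ , refl , sts') , λ
      { (inj₁ (inj₁ x)) → ⋁-refute E (length P) (stepBad P) (step-complete P p st) x
      ; (inj₁ (inj₂ x)) → ∧-refute E (neg isStep) (neg (then 0) ∨ ⋁ R (λ r → neg (then (2 + r))))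
                             (λ ¬p0 _ → ¬p0 p0) x
      ; (inj₂ ¬x) → ¬x (inj₁ p0) }
  ... | no ¬p0 = let E = env (encode c₁) (encode start) p in
    encode start , (start , refl , run) , λ
      { (inj₁ (inj₁ x)) → ⋁-refute E (length P) (stepBad P)
          (λ l → ∧-refute E isStep (Xs l (now 0) ∧ instrBad R l (fetch P l)) (λ p0 _ → ¬p0 p0)) x
      ; (inj₁ (inj₂ x)) → ∧-refute E (neg isStep) (neg (then 0) ∨ ⋁ R (λ r → neg (then (2 + r))))
          (λ { _ (inj₁ ¬l) → ¬l tt
             ; _ (inj₂ y)  → ⋁-refute E R (λ r → neg (then (2 + r))) (λ _ ¬r → ¬r tt) y }) x
      ; (inj₂ ¬x) → ¬x (inj₂ (subst id (sym (Xs-then (encode c₁) (encode start) p n 1 0))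
                                   (≡⇒≡ᵇ n n refl))) }

-- While programs

infixr 5   _⨾_
infix  5.5 _≔_

data Cmd : Set where
  skip  : Cmd
  _≔_   : ℕ → Expr → Cmd
  _⨾_   : Cmd → Cmd → Cmd
  while : ℕ → Cmd → Cmd

data Run : Cmd → Store → Store → Set

Iteration : ℕ → Cmd → Store → Store → Set
Iteration r c ρ ρ' = ∃ λ v → ρ r ≡ suc v × Run c ρ ρ'

data Run where
  skip   : ∀ {ρ} → Run skip ρ ρ
  assign : ∀ {ρ d e v} → ρ ⊢ e ⇓ v → Run (d ≔ e) ρ (ρ [ d ↦ v ])
  _⨾_    : ∀ {c c' ρ ρ₁ ρ₂} → Run c ρ ρ₁ → Run c' ρ₁ ρ₂ → Run (c ⨾ c') ρ ρ₂
  while  : ∀ {r c ρ ρ'} → Star (Iteration r c) ρ ρ' → ρ' r ≡ 0 → Run (while r c) ρ ρ'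

asm : ℕ → Cmd → Program
asm b skip        = []
asm b (d ≔ e)     = set d e ∷ []
asm b (c ⨾ c')    = asm b c ++ asm (b + length (asm b c)) c'
asm b (while r c) =
  -- The exit address skips this test, the body and the closing `br r b b`, an unconditional jump
  -- back.
  br r (2 + b + length (asm (suc b) c)) (suc b) ∷ asm (suc b) c ++ br r b b ∷ []

-- With the end address as an index, blocks split without address arithmetic; `Code-end` computes it
-- where jump targets mention it.
data Code (P : Program) : ℕ → Program → ℕ → Set where
  []  : ∀ {l} → Code P l [] l
  _∷_ : ∀ {l m i is} → fetch P l ≡ just i → Code P (suc l) is m → Code P l (i ∷ is) m

Code-end : ∀ {P l is m} → Code P l is m → m ≡ l + length is
Code-end {l = l} []                = sym (+-identityʳ l)
Code-end {l = l} {_ ∷ is} (_ ∷ cs) = trans (Code-end cs) (sym (+-suc l (length is)))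

Code-++ : ∀ {P l m} is {js} → Code P l (is ++ js) m → ∃ λ k → Code P l is k × Code P k js m
Code-++ []       cs       = _ , [] , cs
Code-++ (_ ∷ is) (c ∷ cs) = let k , cs₁ , cs₂ = Code-++ is cs in k , c ∷ cs₁ , cs₂

Code-fetch : ∀ {P} l is → (∀ j → fetch P (l + j) ≡ fetch is j) → ∃ (Code P l is)
Code-fetch         l []       eq = l , []
Code-fetch {P = P} l (i ∷ is) eq =
  let m , cs = Code-fetch (suc l) is λ j → trans (cong (fetch P) (sym (+-suc l j))) (eq (suc j))
  in m , trans (cong (fetch P) (sym (+-identityʳ l))) (eq 0) ∷ cs

goto : ∀ {P l ρ} r m → fetch P l ≡ just (br r m m) → Step P (l , ρ) (m , ρ)
goto {ρ = ρ} r m eq with ρ r in z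
... | zero  = br0 eq z
... | suc _ = br+ eq z

asm-correct : ∀ {P b m} c {ρ ρ'} → Run c ρ ρ' → Code P b (asm b c) m → Steps P (b , ρ) (m , ρ')
loop-correct : ∀ {P b k n} r c {ρ ρ'} → Star (Iteration r c) ρ ρ' → fetch P b ≡ just (br r n (suc b)) →
               Code P (suc b) (asm (suc b) c) k → fetch P k ≡ just (br r b b) →
               Steps P (b , ρ) (b , ρ')
asm-correct skip     skip        []        = ε
asm-correct (d ≔ e)  (assign ev) (eq ∷ []) = set eq ev ◅ ε
asm-correct {b = b} (c ⨾ c') (run ⨾ run') cs with Code-++ (asm b c) cs
... | k , cs₁ , cs₂ with Code-end cs₁
...   | refl = asm-correct c run cs₁ ◅◅ asm-correct c' run' cs₂
asm-correct {b = b} (while r c) (while its z) (eq ∷ cs) with Code-++ (asm (suc b) c) cs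
... | k , cs₁ , eq' ∷ [] with Code-end cs₁
...   | refl = loop-correct r c its eq cs₁ eq' ◅◅ br0 eq z ◅ ε
loop-correct r c ε                       eq cs eq' = ε
loop-correct {b = b} r c ((_ , s , run) ◅ its) eq cs eq' =
  br+ eq s ◅ asm-correct c run cs ◅◅ goto r b eq' ◅ loop-correct r c its eq cs eq'

-- A loop state before the exit test. It can be extended by a round at the end, as the inductions
-- for `prec` and `mu` require.
Reaches : Cmd → ℕ → Cmd → Store → Store → Set
Reaches c₀ r c ρ ρ' = ∃ λ ρ₁ → Run c₀ ρ ρ₁ × Star (Iteration r c) ρ₁ ρ'

reaches-iterate : ∀ {c₀ r c ρ ρ₁ ρ₂ v} → Reaches c₀ r c ρ ρ₁ → ρ₁ r ≡ suc v → Run c ρ₁ ρ₂ →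
                  Reaches c₀ r c ρ ρ₂
reaches-iterate (_ , run₀ , its) s run = _ , run₀ , its ◅◅ (_ , s , run) ◅ ε

reaches-exit : ∀ {c₀ r c ρ ρ'} → Reaches c₀ r c ρ ρ' → ρ' r ≡ 0 → Run (c₀ ⨾ while r c) ρ ρ'
reaches-exit (_ , run₀ , its) z = run₀ ⨾ while its z

-- Compiling recursive functions

range : ℕ → ∀ j → Vec ℕ j
range b zero    = []
range b (suc j) = b ∷ range (suc b) j

-- Register `b` holds the accumulator, `1 + b` the round index and `2 + b` the number of rounds
-- left.
precInit : Cmd → ℕ → ℕ → Cmd
precInit g x b = g ⨾ 1 + b ≔ const 0 ⨾ 2 + b ≔ copy x

precBody : Cmd → ℕ → Cmd
precBody h b = h ⨾ b ≔ copy (3 + b) ⨾ 1 + b ≔ incr (1 + b) ⨾ 2 + b ≔ decr (2 + b)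

-- compile f ins b reads its arguments from ins, all below b, leaves its result in b,
-- and uses only registers from b on.
compile    : ∀ {k} → Rec k → Vec ℕ k → ℕ → Cmd
compileAll : ∀ {k j} → Vec (Rec k) j → Vec ℕ k → ℕ → Cmd
compile zer              ins        b = b ≔ const 0
compile succ             (x ∷ [])   b = b ≔ incr x
compile (proj i)         ins        b = b ≔ copy (lookup ins i)
compile (comp {j = j} f gs) ins     b =
  compileAll gs ins b ⨾ compile f (range b j) (b + j) ⨾ b ≔ copy (b + j)
compile (prec g h)       (x ∷ ins)  b =
  precInit (compile g ins b) x b ⨾ while (2 + b) (precBody (compile h (1 + b ∷ b ∷ ins) (3 + b)) b)
-- Register `b` holds the candidate and `1 + b` the value there; the first evaluation precedes the
-- loop because the test reads that value.
compile (mu f)           ins        b =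
  (b ≔ const 0 ⨾ compile f (b ∷ ins) (1 + b)) ⨾
  while (1 + b) (b ≔ incr b ⨾ compile f (b ∷ ins) (1 + b))
compileAll []       ins b = skip
compileAll (g ∷ gs) ins b = compile g ins b ⨾ compileAll gs ins (suc b)

-- Correctness of the compilation

AgreeBelow : ℕ → Store → Store → Set
AgreeBelow b ρ ρ' = ∀ {r} → r < b → ρ' r ≡ ρ r

agree-trans : ∀ {b ρ ρ₁ ρ₂} → AgreeBelow b ρ ρ₁ → AgreeBelow b ρ₁ ρ₂ → AgreeBelow b ρ ρ₂
agree-trans ag ag' r<b = trans (ag' r<b) (ag r<b)

agree-≤ : ∀ {b b' ρ ρ'} → b ≤ b' → AgreeBelow b' ρ ρ' → AgreeBelow b ρ ρ'
agree-≤ b≤b' ag r<b = ag (<-≤-trans r<b b≤b')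

agree-↦ : ∀ {b} ρ {d} v → b ≤ d → AgreeBelow b ρ (ρ [ d ↦ v ])
agree-↦ ρ v b≤d r<b = ↦-other ρ v (<⇒≢ (<-≤-trans r<b b≤d))

agree-map : ∀ {b ρ ρ' k} {ins : Vec ℕ k} → All (_< b) ins → AgreeBelow b ρ ρ' → map ρ' ins ≡ map ρ ins
agree-map []           ag = refl
agree-map (r<b ∷ r<bs) ag = cong₂ _∷_ (ag r<b) (agree-map r<bs ag)

below-≤ : ∀ {b b' k} {ins : Vec ℕ k} → b ≤ b' → All (_< b) ins → All (_< b') ins
below-≤ b≤b' = All.map λ r<b → <-≤-trans r<b b≤b'

range-below : ∀ b j → All (_< b + j) (range b j)
range-below b zero    = []
range-below b (suc j) =
  m<m+n b (s≤s z≤n) ∷ subst (λ m → All (_< m) (range (suc b) j)) (sym (+-suc b j)) (range-below (suc b) j)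

-- Arbitrary `b` and `ρ` let subprograms run on any fresh registers, whatever these contain;
-- agreement below `b` preserves arguments and pending results.
Sim : ∀ {k} → Rec k → Vec ℕ k → ℕ → Set
Sim f xs y = ∀ ins b ρ → All (_< b) ins → map ρ ins ≡ xs →
  ∃ λ ρ' → Run (compile f ins b) ρ ρ' × ρ' b ≡ y × AgreeBelow b ρ ρ'

SimAll : ∀ {k j} → Vec (Rec k) j → Vec ℕ k → Vec ℕ j → Set
SimAll {j = j} gs xs ys = ∀ ins b ρ → All (_< b) ins → map ρ ins ≡ xs →
  ∃ λ ρ' → Run (compileAll gs ins b) ρ ρ' × map ρ' (range b j) ≡ ys × AgreeBelow b ρ ρ'

zer-sim : ∀ {k} {xs : Vec ℕ k} → Sim zer xs 0
zer-sim ins b ρ _ _ = _ , assign const , ↦-same ρ b 0 , agree-↦ ρ 0 ≤-refl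

succ-sim : ∀ {x} → Sim succ (x ∷ []) (suc x)
succ-sim (i ∷ []) b ρ _ refl = _ , assign (shift refl) , ↦-same ρ b _ , agree-↦ ρ _ ≤-refl

proj-sim : ∀ {k} {xs : Vec ℕ k} i → Sim (proj i) xs (lookup xs i)
proj-sim i ins b ρ _ refl =
  _ , assign (shift refl) , trans (↦-same ρ b _) (sym (lookup-map i ρ ins)) , agree-↦ ρ _ ≤-refl

[]-sim : ∀ {k} {xs : Vec ℕ k} → SimAll [] xs []
[]-sim ins b ρ _ _ = ρ , skip , refl , λ _ → refl

∷-sim : ∀ {k j} {g : Rec k} {gs : Vec (Rec k) j} {xs y ys} →
        Sim g xs y → SimAll gs xs ys → SimAll (g ∷ gs) xs (y ∷ ys)
∷-sim sg sgs ins b ρ below eq =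
  let ρ₁ , run₁ , y₁ , ag₁ = sg ins b ρ below eq
      ρ₂ , run₂ , ys₂ , ag₂ = sgs ins (suc b) ρ₁ (below-≤ (n≤1+n b) below) (trans (agree-map below ag₁) eq)
  in ρ₂ , run₁ ⨾ run₂ , cong₂ _∷_ (trans (ag₂ ≤-refl) y₁) ys₂ ,
     agree-trans ag₁ (agree-≤ (n≤1+n b) ag₂)

comp-sim : ∀ {k j} {f : Rec j} {gs : Vec (Rec k) j} {xs ys y} →
           SimAll gs xs ys → Sim f ys y → Sim (comp f gs) xs y
comp-sim {j = j} sgs sf ins b ρ below eq =
  let ρ₁ , run₁ , ys₁ , ag₁ = sgs ins b ρ below eq
      ρ₂ , run₂ , y₂ , ag₂ = sf (range b j) (b + j) ρ₁ (range-below b j) ys₁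
  in _ , run₁ ⨾ run₂ ⨾ assign (shift refl) , trans (↦-same ρ₂ b _) y₂ ,
     agree-trans ag₁ (agree-trans (agree-≤ (m≤m+n b j) ag₂) (agree-↦ ρ₂ _ ≤-refl))

-- The loop counts i up and the remaining number k of rounds down, so the derivation for i
-- describes the state of the loop whenever the argument is i + k.
PrecReaches : ∀ {k} → Rec k → Rec (2 + k) → Vec ℕ k → ℕ → ℕ → Set
PrecReaches g h xs i y = ∀ k x ins b ρ → x < b → All (_< b) ins → map ρ ins ≡ xs → ρ x ≡ i + k →
  ∃ λ ρ' → Reaches (precInit (compile g ins b) x b) (2 + b)
                   (precBody (compile h (1 + b ∷ b ∷ ins) (3 + b)) b) ρ ρ' ×
           ρ' b ≡ y × ρ' (1 + b) ≡ i × ρ' (2 + b) ≡ k × AgreeBelow b ρ ρ'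

prec-zero-reaches : ∀ {k} {g : Rec k} {h xs y} → Sim g xs y → PrecReaches g h xs 0 y
prec-zero-reaches sg k x ins b ρ x<b below eq ρx =
  let ρ₁ , run₁ , y₁ , ag₁ = sg ins b ρ below eq
      ρ₂ = ρ₁ [ 1 + b ↦ 0 ]
      ag₂ = agree-↦ ρ₁ 0 (≤-refl {1 + b})
      ρ₃ = ρ₂ [ 2 + b ↦ ρ₂ x ]
      ag₃ = agree-↦ ρ₂ (ρ₂ x) (≤-refl {2 + b})
  in ρ₃ , (ρ₃ , run₁ ⨾ assign const ⨾ assign (shift refl) , ε) ,
     trans (ag₃ (m≤n⇒m≤1+n ≤-refl)) (trans (ag₂ ≤-refl) y₁) ,
     trans (ag₃ ≤-refl) (↦-same ρ₁ (1 + b) 0) ,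
     trans (↦-same ρ₂ (2 + b) (ρ₂ x)) (trans (ag₂ (m≤n⇒m≤1+n x<b)) (trans (ag₁ x<b) ρx)) ,
     agree-trans ag₁ (agree-trans (agree-≤ (n≤1+n b) ag₂) (agree-≤ (m≤n+m b 2) ag₃))

prec-suc-reaches : ∀ {k} {g : Rec k} {h xs i z y} → PrecReaches g h xs i z → Sim h (i ∷ z ∷ xs) y →
                   PrecReaches g h xs (suc i) y
prec-suc-reaches {i = i} reach sh k x ins b ρ x<b below eq ρx =
  -- One round earlier the index is `i` with `suc k` rounds left, for the same argument.
  let ρ₁ , reach₁ , z₁ , i₁ , k₁ , ag₁ =
        reach (suc k) x ins b ρ x<b below eq (trans ρx (sym (+-suc i k)))
      ρ₂ , run₂ , y₂ , ag₂ = sh (1 + b ∷ b ∷ ins) (3 + b) ρ₁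
        (s≤s (n≤1+n (1 + b)) ∷ m<n+m b (s≤s z≤n) ∷ below-≤ (m≤n+m b 3) below)
        (cong₂ _∷_ i₁ (cong₂ _∷_ z₁ (trans (agree-map below ag₁) eq)))
      v₃ = ρ₂ (3 + b)
      ρ₃ = ρ₂ [ b ↦ v₃ ]
      v₄ = suc (ρ₃ (1 + b))
      ρ₄ = ρ₃ [ 1 + b ↦ v₄ ]
      ρ₅ = ρ₄ [ 2 + b ↦ k ]
      k₄ = trans (↦-other ρ₃ v₄ (>⇒≢ ≤-refl))
             (trans (↦-other ρ₂ v₃ (>⇒≢ (n≤1+n (1 + b)))) (trans (ag₂ ≤-refl) k₁))
      ag₄ = agree-↦ ρ₃ v₄ (≤-refl {1 + b})
      ag₅ = agree-↦ ρ₄ k (≤-refl {2 + b})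
  in ρ₅ ,
     reaches-iterate reach₁ k₁ (run₂ ⨾ assign (shift refl) ⨾ assign (shift refl) ⨾ assign (shift k₄)) ,
     trans (ag₅ (n≤1+n (1 + b))) (trans (ag₄ ≤-refl) (trans (↦-same ρ₂ b v₃) y₂)) ,
     trans (ag₅ ≤-refl) (trans (↦-same ρ₃ (1 + b) v₄)
       (cong suc (trans (↦-other ρ₂ v₃ (>⇒≢ ≤-refl)) (trans (ag₂ (s≤s (n≤1+n (1 + b)))) i₁)))) ,
     ↦-same ρ₄ (2 + b) k ,
     agree-trans ag₁ (agree-trans (agree-≤ (m≤n+m b 3) ag₂) (agree-trans (agree-↦ ρ₂ v₃ ≤-refl)
       (agree-trans (agree-≤ (n≤1+n b) ag₄) (agree-≤ (m≤n+m b 2) ag₅))))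

prec-sim : ∀ {k} {g : Rec k} {h xs i y} → PrecReaches g h xs i y → Sim (prec g h) (i ∷ xs) y
prec-sim {i = i} reach (x ∷ ins) b ρ (x<b ∷ below) refl =
  let ρ' , reach' , y' , _ , z , ag = reach 0 x ins b ρ x<b below refl (sym (+-identityʳ i))
  in ρ' , reaches-exit reach' z , y' , ag

-- The positive values from `s+` keep the loop going through all candidates below `n`; the value 0
-- at `n` ends it.
mu-sim : ∀ {k} {f : Rec (suc k)} {xs n} → Sim f (n ∷ xs) 0 →
         (∀ i → i < n → ∃ λ v → Sim f (i ∷ xs) (suc v)) → Sim (mu f) xs n
mu-sim {f = f} {xs} {n} s0 s+ ins b ρ below eq =
  let ρ' , reach' , n' , z , ag = reach n 0 ≤-refl s0 in ρ' , reaches-exit reach' z , n' , ag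
  where
  evaluate : ∀ ρ₁ {i w} → AgreeBelow b ρ ρ₁ → ρ₁ b ≡ i → Sim f (i ∷ xs) w →
    ∃ λ ρ' → Run (compile f (b ∷ ins) (1 + b)) ρ₁ ρ' × ρ' b ≡ i × ρ' (1 + b) ≡ w × AgreeBelow b ρ ρ'
  evaluate ρ₁ ag i₁ sf =
    let ρ₂ , run₂ , w₂ , ag₂ = sf (b ∷ ins) (1 + b) ρ₁ (≤-refl ∷ below-≤ (n≤1+n b) below)
                                  (cong₂ _∷_ i₁ (trans (agree-map below ag) eq))
    in ρ₂ , run₂ , trans (ag₂ ≤-refl) i₁ , w₂ , agree-trans ag (agree-≤ (n≤1+n b) ag₂)
  reach : ∀ i w → i ≤ n → Sim f (i ∷ xs) w →
    ∃ λ ρ' → Reaches (b ≔ const 0 ⨾ compile f (b ∷ ins) (1 + b)) (1 + b)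
                     (b ≔ incr b ⨾ compile f (b ∷ ins) (1 + b)) ρ ρ' ×
             ρ' b ≡ i × ρ' (1 + b) ≡ w × AgreeBelow b ρ ρ'
  reach zero w _ sf =
    let ρ₂ , run , res = evaluate (ρ [ b ↦ 0 ]) (agree-↦ ρ 0 ≤-refl) (↦-same ρ b 0) sf
    in ρ₂ , (ρ₂ , assign const ⨾ run , ε) , res
  reach (suc i) w i<n sf =
    let v , sf' = s+ i i<n
        ρ₁ , reach₁ , i₁ , v₁ , ag₁ = reach i (suc v) (<⇒≤ i<n) sf'
        ρ₂ , run , res = evaluate (ρ₁ [ b ↦ suc (ρ₁ b) ]) (agree-trans ag₁ (agree-↦ ρ₁ _ ≤-refl))
                                  (trans (↦-same ρ₁ b _) (cong suc i₁)) sf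
    in ρ₂ , reaches-iterate reach₁ v₁ (assign (shift refl) ⨾ run) , res

eval-sim     : ∀ {k} {f : Rec k} {xs y} → Eval f xs y → Sim f xs y
eval-sims    : ∀ {k j} {gs : Vec (Rec k) j} {xs ys} → EvalAll gs xs ys → SimAll gs xs ys
-- A subderivation for `prec` describes an intermediate loop state, not a finished call, hence this
-- second reading beside `eval-sim`.
eval-reaches : ∀ {k} {g : Rec k} {h xs i y} → Eval (prec g h) (i ∷ xs) y → PrecReaches g h xs i y
eval-Σsim    : ∀ {k} {f : Rec k} {xs} → (∃ λ v → Eval f xs (suc v)) → ∃ λ v → Sim f xs (suc v)
eval-sim e-zer           = zer-sim
eval-sim e-succ          = succ-sim
eval-sim (e-proj i)      = proj-sim i
eval-sim (e-comp es e)   = comp-sim (eval-sims es) (eval-sim e)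
eval-sim (e-prec0 e)     = prec-sim (prec-zero-reaches (eval-sim e))
eval-sim (e-precS e e')  = prec-sim (prec-suc-reaches (eval-reaches e) (eval-sim e'))
eval-sim (e-mu e es)     = mu-sim (eval-sim e) λ i i<n → eval-Σsim (es i i<n)
eval-sims ea-[]          = []-sim
eval-sims (ea-∷ e es)    = ∷-sim (eval-sim e) (eval-sims es)
eval-reaches (e-prec0 e)    = prec-zero-reaches (eval-sim e)
eval-reaches (e-precS e e') = prec-suc-reaches (eval-reaches e) (eval-sim e')
eval-Σsim (v , e) = v , eval-sim e

-- The result lands in register 1. The appended test jumps to itself on 0 and to `stop` otherwise.
program : Rec 1 → Program
program f = is ++ br 1 (length is) (suc (length is)) ∷ stop ∷ []
  where is = asm 0 (compile f (0 ∷ []) 1)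

module _ {f : Rec 1} {n y : ℕ} (e : Eval f (n ∷ []) y) where
  private
    P = program f
    c = compile f (0 ∷ []) 1
    L = length (asm 0 c)

  program-runs : ∃ λ ρ → Steps P (0 , input n) (L , ρ) × ρ 1 ≡ y ×
                 fetch P L ≡ just (br 1 L (suc L)) × fetch P (suc L) ≡ just stop
  program-runs with Code-++ (asm 0 c) (proj₂ (Code-fetch {P} 0 P λ _ → refl))
  ... | l , cs , eq ∷ eq' ∷ _ with Code-end cs
  ...   | refl =
    let ρ , run , ρ1 , _ = eval-sim e (0 ∷ []) 1 (input n) (s≤s z≤n ∷ []) refl
    in ρ , asm-correct c run cs , ρ1 , eq , eq'

eval-zero⇒satisfiable : ∀ f {n} → Eval f (n ∷ []) 0 → Satisfiable (runs (bad (program f)) n)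
eval-zero⇒satisfiable f {n} e =
  let _ , run , z , eq , _ = program-runs e in looping⇒satisfiable (program f) n run (br0 eq z)

eval-suc⇒unsatisfiable : ∀ f {n y} → Eval f (n ∷ []) (suc y) → ¬ Satisfiable (runs (bad (program f)) n)
eval-suc⇒unsatisfiable f {n} e =
  let _ , run , s , eq , eq' = program-runs e
  in halting⇒unsatisfiable (program f) n (run ◅◅ br+ eq s ◅ ε) eq'

-- Computing the code of the diagonal formula

comp₁ : ∀ {k} {f : Rec 1} {g : Rec k} {xs x y} → Eval g xs x → Eval f (x ∷ []) y → Eval (comp f (g ∷ [])) xs y
comp₁ e e' = e-comp (ea-∷ e ea-[]) e'

comp₂ : ∀ {k} {f : Rec 2} {g h : Rec k} {xs x y z} → Eval g xs x → Eval h xs y → Eval f (x ∷ y ∷ []) z →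
        Eval (comp f (g ∷ h ∷ [])) xs z
comp₂ e e' e'' = e-comp (ea-∷ e (ea-∷ e' ea-[])) e''

numeral : ∀ {k} → ℕ → Rec k
numeral zero    = zer
numeral (suc c) = comp succ (numeral c ∷ [])

numeral-eval : ∀ {k} {xs : Vec ℕ k} c → Eval (numeral c) xs c
numeral-eval zero    = e-zer
numeral-eval (suc c) = comp₁ (numeral-eval c) e-succ

double : Rec 1
double = prec zer (comp succ (comp succ (proj (suc zero) ∷ []) ∷ []))

double-eval : ∀ n → Eval double (n ∷ []) (2 * n)
double-eval zero    = e-prec0 e-zer
double-eval (suc n) = subst (Eval double (suc n ∷ [])) (cong suc (sym (+-suc n (n + 0))))
  (e-precS (double-eval n) (comp₁ (comp₁ (e-proj (suc zero)) e-succ) e-succ))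

pairing : Rec 2
pairing = prec (comp succ (double ∷ [])) (comp double (proj (suc zero) ∷ []))

pairing-eval : ∀ a b → Eval pairing (a ∷ b ∷ []) (pair a b)
pairing-eval zero    b = subst (Eval pairing (0 ∷ b ∷ []))
  (trans (+-comm 1 (2 * b)) (sym (*-identityˡ (2 * b + 1))))
  (e-prec0 (comp₁ (double-eval b) e-succ))
pairing-eval (suc a) b = subst (Eval pairing (suc a ∷ b ∷ []))
  (sym (*-assoc 2 (2 ^ a) (2 * b + 1)))
  (e-precS (pairing-eval a b) (comp₁ (e-proj (suc zero)) (double-eval (pair a b))))

pairᴿ : ∀ {k} → Rec k → Rec k → Rec k
pairᴿ f g = comp pairing (f ∷ g ∷ [])

pairᴿ-eval : ∀ {k} {f g : Rec k} {xs a b} → Eval f xs a → Eval g xs b → Eval (pairᴿ f g) xs (pair a b)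
pairᴿ-eval e e' = comp₂ e e' (pairing-eval _ _)

tagᴿ : ∀ {k} → ℕ → Rec k → Rec k
tagᴿ c = pairᴿ (numeral c)

tagᴿ-eval : ∀ {k} {f : Rec k} {xs x} c → Eval f xs x → Eval (tagᴿ c f) xs (tag c x)
tagᴿ-eval c = pairᴿ-eval (numeral-eval c)

-- A record instead of a bare Eval keeps the typechecker from normalising the astronomical codes.
record EvalB {k n m} (f : Rec k) (xs : Vec ℕ k) (ψ : Body n m) : Set where
  constructor evalB
  field eval : Eval f xs (codeB ψ)

record EvalF {k n m} (f : Rec k) (xs : Vec ℕ k) (φ : Formula n m) : Set where
  constructor evalF
  field eval : Eval f xs (code φ)

module _ {k : ℕ} {xs : Vec ℕ k} {n m : ℕ} where

  body-eval : ∀ {f} {ψ : Body n m} → EvalB f xs ψ → EvalF (tagᴿ 4 f) xs (body ψ)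
  body-eval (evalB e) = evalF (tagᴿ-eval 4 e)

  ∀π-eval : ∀ {f} {φ : Formula (suc n) m} → EvalF f xs φ → EvalF (tagᴿ 0 f) xs (∀π φ)
  ∀π-eval (evalF e) = evalF (tagᴿ-eval 0 e)

  ∃π-eval : ∀ {f} {φ : Formula (suc n) m} → EvalF f xs φ → EvalF (tagᴿ 1 f) xs (∃π φ)
  ∃π-eval (evalF e) = evalF (tagᴿ-eval 1 e)

  ∀q-eval : ∀ {f} {φ : Formula n (suc m)} → EvalF f xs φ → EvalF (tagᴿ 3 f) xs (∀q φ)
  ∀q-eval (evalF e) = evalF (tagᴿ-eval 3 e)

  neg-eval : ∀ {f} {ψ : Body n m} → EvalB f xs ψ → EvalB (tagᴿ 2 f) xs (neg ψ)
  neg-eval (evalB e) = evalB (tagᴿ-eval 2 e)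

  ∨-eval : ∀ {f g} {ψ χ : Body n m} → EvalB f xs ψ → EvalB g xs χ → EvalB (tagᴿ 3 (pairᴿ f g)) xs (ψ ∨ χ)
  ∨-eval (evalB e) (evalB e') = evalB (tagᴿ-eval 3 (pairᴿ-eval e e'))

-- Each `X` applies `tag 4` to the code, so primitive recursion on the number of `X` operators
-- computes it.
Xsᴿ : ∀ {n m} → Body n m → Rec 1
Xsᴿ ψ = prec (numeral (codeB ψ)) (tagᴿ 4 (proj (suc zero)))

Xsᴿ-eval : ∀ {n m} (ψ : Body n m) k → EvalB (Xsᴿ ψ) (k ∷ []) (Xs k ψ)
Xsᴿ-eval ψ k = evalB (go k)
  where
  go : ∀ k → Eval (Xsᴿ ψ) (k ∷ []) (codeB (Xs k ψ))
  go zero    = e-prec0 (numeral-eval (codeB ψ))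
  go (suc k) = e-precS (go k) (tagᴿ-eval 4 (e-proj (suc zero)))

-- The argument enters twice, as the code of `V` and as the input `n`: this is the self-application.
-- The tags follow the connectives of `runs`.
diagonal : Rec 1
diagonal = tagᴿ 3 (tagᴿ 0 (tagᴿ 1 (tagᴿ 4 (tagᴿ 2 (tagᴿ 3 (pairᴿ (proj zero)
  (tagᴿ 2 (tagᴿ 3 (pairᴿ (numeral (codeB isStep)) (Xsᴿ (then 1)))))))))))

diagonal-eval : ∀ V → EvalF diagonal (codeB V ∷ []) (runs V (codeB V))
diagonal-eval V = ∀q-eval (∀π-eval (∃π-eval (body-eval (neg-eval (∨-eval (evalB (e-proj zero))
  (neg-eval (∨-eval (evalB (numeral-eval (codeB isStep))) (Xsᴿ-eval (then 1) (codeB V)))))))))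

-- Abstracting over V keeps the code of the actual formula from being normalised.
refute-decision : ∀ {d} V → let φ = runs V (codeB V); f = comp d (diagonal ∷ []) in
  (Eval f (codeB V ∷ []) 0 → Satisfiable φ) → (Eval f (codeB V ∷ []) 1 → ¬ Satisfiable φ) →
  ¬ ((Eval d (code φ ∷ []) 1 × Satisfiable φ) ⊎ (Eval d (code φ ∷ []) 0 × ¬ Satisfiable φ))
refute-decision V zero⇒sat one⇒unsat (inj₁ (e , sat)) =
  one⇒unsat (comp₁ (EvalF.eval (diagonal-eval V)) e) sat
refute-decision V zero⇒sat one⇒unsat (inj₂ (e , unsat)) =
  unsat (zero⇒sat (comp₁ (EvalF.eval (diagonal-eval V)) e))

theorem7 : ¬ (Σ (Rec 1) λ d → DecidesSatAE d)
theorem7 (d , decides) =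
  refute-decision V (eval-zero⇒satisfiable f) (eval-suc⇒unsatisfiable f) (decides (runs V (codeB V)) refl)
  where
  -- On input `codeB V`, the machine of `f` asks `d` about the very formula saying that this run
  -- never halts.
  f = comp d (diagonal ∷ [])
  V = bad (program f)
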